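{- For every $g\in\mathbb{N}$ there exists a graph $G$ with odd-girth greater than or equal to $g$ that does not have the AOP property.
   Context: All graphs are finite, simple and undirected. The odd-girth of a graph is the number of edges in a shortest odd cycle (a graph without odd cycles is regarded as having infinite odd-girth). An orientation of $G$ assigns exactly one direction to each edge; it is acyclic if it has no directed cycle. A graph $G$ has the AOP (acyclic one path) property if it has an acyclic orientation such that there is at most one directed path between any two vertices, i.e. for all distinct vertices $u,v$ there is at most one directed path from $u$ to $v$. -}

module Defs where

open import Data.Fin.Base using (Fin)
open import Data.List.Base using (List; []; _∷_; length)
open import Data.List.Relation.Unary.Unique.Propositional using (Unique)
open import Data.Nat.Base using (ℕ; _≤_)
open import Data.Nat.Divisibility using (_∣_)
open import Data.Product.Base using (Σ-syntax; _×_)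
open import Data.Sum.Base using (_⊎_)
open import Level using (0ℓ)
open import Relation.Binary.Construct.Closure.ReflexiveTransitive using (Star; ε; _◅_)
open import Relation.Binary.Core using (Rel)
open import Relation.Binary.Definitions using (Symmetric; Asymmetric; Decidable)
open import Relation.Binary.PropositionalEquality.Core using (_≡_; _≢_)
open import Relation.Nullary.Construct.Add.Supremum using (_⁺; [_]; ⊤⁺)
open import Relation.Nullary.Negation.Core using (¬_)

import Relation.Binary.Construct.Add.Supremum.NonStrict as AddSupremum

record Graph : Set₁ where
  field
    order  : ℕ
    Adj    : Rel (Fin order) 0ℓ
    adj?   : Decidable Adj
    sym    : Symmetric Adj
    irrefl : ∀ v → ¬ Adj v v

  Vertex : Set
  Vertex = Fin order

module _ {V : Set} {R : Rel V 0ℓ} where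

  vertices : ∀ {u v} → Star R u v → List V
  vertices {u} ε       = u ∷ []
  vertices {u} (_ ◅ w) = u ∷ vertices w

  IsPath : ∀ {u v} → Star R u v → Set
  IsPath w = Unique (vertices w)

-- A cycle is a path together with a step from its last vertex back to its
-- first.  Loops and cycles of length two are not excluded here.
record Cycle {V : Set} (R : Rel V 0ℓ) : Set where
  field
    {first last} : V
    walk         : Star R first last
    isPath       : IsPath walk
    closing      : R last first

  -- There are as many edges, the closing one included, as vertices.
  cycleLength : ℕ
  cycleLength = length (vertices walk)

open Cycle public using (cycleLength)

record OddCycle (G : Graph) : Set where
  field
    cycle  : Cycle (Graph.Adj G)
    3≤size : 3 ≤ cycleLength cycle
    odd    : ¬ (2 ∣ cycleLength cycle)

  size : ℕ
  size = cycleLength cycle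

-- ⊤⁺ is the infinite value.
ℕ∞ : Set
ℕ∞ = ℕ ⁺

open AddSupremum _≤_ public using () renaming (_≤⁺_ to _≤∞_)

HasOddGirth : Graph → ℕ∞ → Set
HasOddGirth G [ k ] =
  (Σ[ C ∈ OddCycle G ] OddCycle.size C ≡ k) × (∀ (C : OddCycle G) → k ≤ OddCycle.size C)
HasOddGirth G ⊤⁺    = ¬ OddCycle G

record Orientation (G : Graph) : Set₁ where
  open Graph G
  field
    Arc      : Rel Vertex 0ℓ
    arc⇒adj  : ∀ {u v} → Arc u v → Adj u v
    oriented : ∀ {u v} → Adj u v → Arc u v ⊎ Arc v u
    asym     : Asymmetric Arc

Acyclic : ∀ {G} → Orientation G → Set
Acyclic O = ¬ Cycle (Orientation.Arc O)

-- Paths are compared through their vertex sequences, so that different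
-- proofs of the same arc do not count as different paths.
AtMostOnePath : ∀ {G} → Orientation G → Set
AtMostOnePath {G} O =
  ∀ {u v : Graph.Vertex G} → u ≢ v →
  (p q : Star (Orientation.Arc O) u v) → IsPath p → IsPath q →
  vertices p ≡ vertices q

AOP : Graph → Set₁
AOP G = Σ[ O ∈ Orientation G ] Acyclic O × AtMostOnePath O

{-# OPTIONS --safe #-}

-- In an acyclic orientation with at most one path between any two vertices,
-- every 4-cycle alternates between sources and sinks.  If every vertex u has
-- a twin, any two edges at u lie on a common 4-cycle, through u and its twin;
-- hence every vertex is a source or a sink, which is impossible along an odd
-- cycle.  Doubling every vertex of the cycle of odd length n provides twins,
-- and keeps the odd-girth equal to n: the steps ±1 of an odd closed walk
-- cannot cancel out, so they sum to a nonzero multiple of n.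
module Submission where

open import Defs
open import Data.Fin.Base using (Fin; zero; suc; combine; opposite; quotient; remainder; toℕ)
open import Data.Fin.Properties using (combine-injectiveˡ; combine-remQuot; remQuot-combine; toℕ-fromℕ<)
open import Data.List.Base using (_∷_; []; length; applyDownFrom)
open import Data.List.Properties using (length-applyDownFrom; ∷-injectiveʳ; ∷-injectiveˡ)
open import Data.List.Relation.Unary.All using ([]; _∷_)
open import Data.List.Relation.Unary.AllPairs using ([]; _∷_)
open import Data.List.Relation.Unary.Unique.Propositional.Properties using (applyDownFrom⁺₁)
open import Data.Nat.Base using (ℕ; zero; suc; _+_; _*_; _≤_; _<_; NonZero; s≤s; z≤n)
open import Data.Nat.Divisibility using (_∣_; _∣?_; divides; divides-refl; m∣m*n; ∣-refl; ∣⇒≤; >⇒∤; ∣m∣n⇒∣m+n; ∣m+n∣m⇒∣n)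
open import Data.Nat.DivMod using (_%_; _/_; _mod_; m%n<n; m≡m%n+[m/n]*n; m%n%n≡m%n; n%n≡0; m<n⇒m%n≡m; %-distribˡ-+)
open import Data.Nat.Properties using (_≟_; <-cmp; <-trans; ≤-refl; ≤-trans; <⇒≢; +-suc; +-comm; +-assoc; +-identityʳ; +-cancelˡ-≡; m≤m+n; m≤n+m; m≤n⇒∃[o]m+o≡n)
open import Data.Product.Base using (Σ-syntax; ∃₂; _×_; _,_; proj₁; proj₂)
open import Data.Sum.Base using (_⊎_; inj₁; inj₂; swap)
open import Function.Base using (_∘_)
open import Relation.Binary.Construct.Closure.ReflexiveTransitive using (Star; ε; _◅_)
open import Relation.Binary.Construct.Add.Supremum.NonStrict using ([_])
open import Relation.Binary.Definitions using (tri<; tri≈; tri>)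
open import Relation.Binary.PropositionalEquality using (_≡_; _≢_; refl; sym; trans; cong; subst; ≢-sym; module ≡-Reasoning)
open import Relation.Nullary.Construct.Add.Supremum using ([_])
open import Relation.Nullary.Decidable.Core using (from-no; _⊎-dec_)
open import Relation.Nullary.Negation.Core using (¬_; contradiction)

-- Twins and orientations with the AOP property.

record Twin (G : Graph) (u : Graph.Vertex G) : Set where
  open Graph G
  field
    twin     : Vertex
    distinct : twin ≢ u
    adjacent : ∀ {v} → Adj u v → Adj twin v

module _ {G : Graph} where
  open Graph G using (Vertex; Adj; irrefl) renaming (sym to Adj-sym)

  adj⇒≢ : ∀ {u v} → Adj u v → u ≢ v
  adj⇒≢ a refl = irrefl _ a

  -- An odd number of vertices means an even number of steps, which are consumed in pairs.
  two-step-invariant : (P : Vertex → Set) →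
                       (∀ {u v w} → Adj u v → Adj v w → P u → P w) →
                       ∀ {u v} (w : Star Adj u v) → ¬ (2 ∣ length (vertices w)) → P u → P v
  two-step-invariant P step ε           odd pu = pu
  two-step-invariant P step (a ◅ ε)     odd pu = contradiction ∣-refl odd
  two-step-invariant P step (a ◅ b ◅ w) odd pu =
    two-step-invariant P step w (odd ∘ ∣m∣n⇒∣m+n ∣-refl) (step a b pu)

  module _ (O : Orientation G) (acyclic : Acyclic {G} O) (onePath : AtMostOnePath {G} O) where
    open Orientation O

    arc⇒≢ : ∀ {u v} → Arc u v → u ≢ v
    arc⇒≢ = adj⇒≢ ∘ arc⇒adj

    -- The arcs `d→a` and `a→b` lie on a 4-cycle through `c`. The two remaining edges complete them
    -- to a directed cycle, to a three-arc path beside a single arc (in two ways), or to two paths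
    -- from `d` to `b`.
    no-through-vertex : ∀ {a b c d} → a ≢ c → b ≢ d → Adj b c → Adj c d →
                        Arc d a → ¬ Arc a b
    no-through-vertex a≢c b≢d bc cd d→a a→b with oriented bc | oriented cd
    ... | inj₁ b→c | inj₁ c→d = acyclic record
      { walk    = a→b ◅ b→c ◅ c→d ◅ ε
      ; isPath  = (arc⇒≢ a→b ∷ a≢c ∷ ≢-sym (arc⇒≢ d→a) ∷ [])
                ∷ (arc⇒≢ b→c ∷ b≢d ∷ []) ∷ (arc⇒≢ c→d ∷ []) ∷ [] ∷ []
      ; closing = d→a
      }
    ... | inj₁ b→c | inj₂ d→c
      with () ← onePath (arc⇒≢ d→c) (d→a ◅ a→b ◅ b→c ◅ ε) (d→c ◅ ε)
                  ((arc⇒≢ d→a ∷ ≢-sym b≢d ∷ arc⇒≢ d→c ∷ [])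
                    ∷ (arc⇒≢ a→b ∷ a≢c ∷ []) ∷ (arc⇒≢ b→c ∷ []) ∷ [] ∷ [])
                  ((arc⇒≢ d→c ∷ []) ∷ [] ∷ [])
    ... | inj₂ c→b | inj₁ c→d
      with () ← onePath (arc⇒≢ c→b) (c→d ◅ d→a ◅ a→b ◅ ε) (c→b ◅ ε)
                  ((arc⇒≢ c→d ∷ ≢-sym a≢c ∷ arc⇒≢ c→b ∷ [])
                    ∷ (arc⇒≢ d→a ∷ ≢-sym b≢d ∷ []) ∷ (arc⇒≢ a→b ∷ []) ∷ [] ∷ [])
                  ((arc⇒≢ c→b ∷ []) ∷ [] ∷ [])
    ... | inj₂ c→b | inj₂ d→c =
      a≢c (∷-injectiveˡ (∷-injectiveʳ
        (onePath (≢-sym b≢d) (d→a ◅ a→b ◅ ε) (d→c ◅ c→b ◅ ε)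
          ((arc⇒≢ d→a ∷ ≢-sym b≢d ∷ []) ∷ (arc⇒≢ a→b ∷ []) ∷ [] ∷ [])
          ((arc⇒≢ d→c ∷ ≢-sym b≢d ∷ []) ∷ (arc⇒≢ c→b ∷ []) ∷ [] ∷ []))))

    IsSource IsSink : Vertex → Set
    IsSource u = ∀ {v} → Adj u v → Arc u v
    IsSink   u = ∀ {v} → Adj u v → Arc v u

    module _ (twins : ∀ u → Twin G u) where

      -- The twin of `u` is adjacent to both `v` and `w`, hence closes a 4-cycle.
      no-directed-two-path : ∀ {u v w} → Arc u v → ¬ Arc w u
      no-directed-two-path {u} u→v w→u =
        -- If `v` and `w` coincided, a single edge would be oriented both ways.
        no-through-vertex (≢-sym distinct) (λ { refl → asym u→v w→u })
          (Adj-sym (adjacent (arc⇒adj u→v))) (adjacent (Adj-sym (arc⇒adj w→u))) w→u u→v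
        where open Twin (twins u)

      tail-isSource : ∀ {u v} → Arc u v → IsSource u
      tail-isSource u→v uw with oriented uw
      ... | inj₁ u→w = u→w
      ... | inj₂ w→u = contradiction w→u (no-directed-two-path u→v)

      head-isSink : ∀ {u v} → Arc u v → IsSink v
      head-isSink u→v vw with oriented vw
      ... | inj₁ v→w = contradiction u→v (no-directed-two-path v→w)
      ... | inj₂ w→v = w→v

      -- Neighbours of sinks are sources and conversely, so `first` and `last`, an even number of
      -- steps apart, are of the same kind. The closing edge joins them, which forces both of its
      -- directions.
      no-oddCycle : ¬ OddCycle G
      no-oddCycle C with oriented closing
        where open Cycle (OddCycle.cycle C)
      ... | inj₁ last→first = asym last→first
        (two-step-invariant IsSink
          (λ uv vw sink → head-isSink (tail-isSource (sink uv) vw))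
          walk odd (head-isSink last→first) closing)
        where
        open OddCycle C
        open Cycle cycle
      ... | inj₂ first→last = asym first→last
        (two-step-invariant IsSource
          (λ uv vw source → tail-isSource (head-isSink (source uv) vw))
          walk odd (tail-isSource first→last) closing)
        where
        open OddCycle C
        open Cycle cycle

twins∧oddCycle⇒¬AOP : (G : Graph) → (∀ u → Twin G u) → OddCycle G → ¬ AOP G
twins∧oddCycle⇒¬AOP G twins C (O , acyclic , onePath) = no-oddCycle O acyclic onePath twins C

-- Congruence modulo `n`.

module Congruence (n : ℕ) .{{_ : NonZero n}} where

  infix 4 _≋_
  -- Encoded by remainders, so that `_≟_` on numbers decides it.
  _≋_ : ℕ → ℕ → Set
  a ≋ b = a % n ≡ b % n

  +-congʳ-≋ : ∀ {a b} c → a ≋ b → a + c ≋ b + c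
  +-congʳ-≋ {a} {b} c a≋b = begin
    (a + c) % n          ≡⟨ %-distribˡ-+ a c n ⟩
    (a % n + c % n) % n  ≡⟨ cong (λ r → (r + c % n) % n) a≋b ⟩
    (b % n + c % n) % n  ≡⟨ %-distribˡ-+ b c n ⟨
    (b + c) % n          ∎
    where open ≡-Reasoning

  suc-cong-≋ : ∀ {a b} → a ≋ b → suc a ≋ suc b
  suc-cong-≋ {a} {b} a≋b rewrite +-comm 1 a | +-comm 1 b = +-congʳ-≋ {a} {b} 1 a≋b

  -- Cancelling the common remainder exhibits `d` as a difference of two multiples of `n`.
  a+d≋a⇒n∣d : ∀ a d → a + d ≋ a → n ∣ d
  a+d≋a⇒n∣d a d eq = ∣m+n∣m⇒∣n (divides ((a + d) / n) q) (divides-refl (a / n))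
    where
    open ≡-Reasoning
    q : a / n * n + d ≡ (a + d) / n * n
    q = +-cancelˡ-≡ (a % n) _ _ (begin
      a % n + (a / n * n + d)              ≡⟨ +-assoc (a % n) _ d ⟨
      a % n + a / n * n + d                ≡⟨ cong (_+ d) (m≡m%n+[m/n]*n a n) ⟨
      a + d                                ≡⟨ m≡m%n+[m/n]*n (a + d) n ⟩
      (a + d) % n + (a + d) / n * n        ≡⟨ cong (_+ (a + d) / n * n) eq ⟩
      a % n + (a + d) / n * n              ∎)

  -- The difference of `q` and `p` is a positive multiple of `n`, and it is at most `q`.
  shift-<⇒n≤ : ∀ a {p q} → p < q → a + q ≋ a + p → n ≤ q
  shift-<⇒n≤ a {p} p<q eq with m≤n⇒∃[o]m+o≡n p<q
  ... | o , refl = ≤-trans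
    (∣⇒≤ (a+d≋a⇒n∣d (a + p) (suc o) (trans (cong (_% n) a+p+suc-o) eq)))
    (subst (suc o ≤_) (+-suc p o) (m≤n+m (suc o) p))
    where
    a+p+suc-o : a + p + suc o ≡ a + (suc p + o)
    a+p+suc-o = trans (+-assoc a p (suc o)) (cong (a +_) (+-suc p o))

  -- Meant for `p` steps up and `q` steps down along a closed walk of length `p + q`; the larger of
  -- the two is already at least `n`.
  distinct-shifts⇒n≤ : ∀ a p q → p ≢ q → a + p ≋ a + q → n ≤ p + q
  distinct-shifts⇒n≤ a p q p≢q eq with <-cmp p q
  ... | tri< p<q _ _ = ≤-trans (shift-<⇒n≤ a p<q (sym eq)) (m≤n+m q p)
  ... | tri≈ _ p≡q _ = contradiction p≡q p≢q
  ... | tri> _ _ q<p = ≤-trans (shift-<⇒n≤ a q<p eq) (m≤m+n p q)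

  suc≉ : 1 < n → ∀ a → ¬ suc a ≋ a
  suc≉ 1<n a eq = >⇒∤ 1<n (a+d≋a⇒n∣d a 1 (trans (cong (_% n) (+-comm a 1)) eq))

-- The doubled cycle and the lower bound on its odd cycles.

opposite₂-≢ : (i : Fin 2) → opposite i ≢ i
opposite₂-≢ zero       ()
opposite₂-≢ (suc zero) ()

module DoubledCycle (n : ℕ) .{{_ : NonZero n}} (1<n : 1 < n) where
  open Congruence n

  -- A vertex encodes a pair of a copy in `Fin 2` and a place on the cycle. Adjacency looks only at
  -- the place, so switching the copy gives a twin.
  position : Fin (2 * n) → ℕ
  position u = toℕ (remainder {2} n u)

  position-combine : ∀ (i : Fin 2) (j : Fin n) → position (combine i j) ≡ toℕ j
  position-combine i j = cong (toℕ ∘ proj₂) (remQuot-combine i j)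

  doubledCycle : Graph
  doubledCycle = record
    { order  = 2 * n
    ; Adj    = λ u v → suc (position u) ≋ position v ⊎ suc (position v) ≋ position u
    ; adj?   = λ u v → (_ ≟ _) ⊎-dec (_ ≟ _)
    ; sym    = swap
    ; irrefl = λ { v (inj₁ eq) → suc≉ 1<n (position v) eq ; v (inj₂ eq) → suc≉ 1<n (position v) eq }
    }

  open Graph doubledCycle using (Vertex; Adj)

  twins : ∀ u → Twin doubledCycle u
  twins u = record
    { twin     = combine (opposite i) j
    ; distinct = λ eq → opposite₂-≢ i
        (combine-injectiveˡ (opposite i) j i j (trans eq (sym (combine-remQuot {2} n u))))
    ; adjacent = λ {v} → subst
        (λ a → suc a ≋ position v ⊎ suc (position v) ≋ a)
        (sym (position-combine (opposite i) j))
    }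
    where
    i = quotient {2} n u
    j = remainder {2} n u

  -- `p` counts the steps up and `q` the steps down. Stating the balance additively avoids
  -- subtraction; including the final step to `x` makes `p + q` the number of vertices of `w`, which
  -- is the cycle length when `x` is `u`.
  drift : ∀ {u v x} (w : Star Adj u v) → Adj v x →
          ∃₂ λ p q → p + q ≡ length (vertices w) × position u + p ≋ position x + q
  drift {u} {x = x} ε (inj₁ up) = 1 , 0 , refl , (begin
    (position u + 1) % n  ≡⟨ cong (_% n) (+-comm (position u) 1) ⟩
    suc (position u) % n  ≡⟨ up ⟩
    position x % n        ≡⟨ cong (_% n) (+-identityʳ (position x)) ⟨
    (position x + 0) % n  ∎)
    where open ≡-Reasoning
  drift {u} {x = x} ε (inj₂ down) = 0 , 1 , refl , (begin
    (position u + 0) % n  ≡⟨ cong (_% n) (+-identityʳ (position u)) ⟩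
    position u % n        ≡⟨ down ⟨
    suc (position x) % n  ≡⟨ cong (_% n) (+-comm 1 (position x)) ⟩
    (position x + 1) % n  ∎)
    where open ≡-Reasoning
  drift {u} {x = x} (_◅_ {j = y} (inj₁ up) w) vx with drift w vx
  ... | p , q , p+q≡ , eq = suc p , q , cong suc p+q≡ , (begin
    (position u + suc p) % n  ≡⟨ cong (_% n) (+-suc (position u) p) ⟩
    (suc (position u) + p) % n ≡⟨ +-congʳ-≋ {suc (position u)} p up ⟩
    (position y + p) % n      ≡⟨ eq ⟩
    (position x + q) % n      ∎)
    where open ≡-Reasoning
  drift {u} {x = x} (_◅_ {j = y} (inj₂ down) w) vx with drift w vx
  ... | p , q , p+q≡ , eq = p , suc q , trans (+-suc p q) (cong suc p+q≡) , (begin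
    (position u + p) % n        ≡⟨ +-congʳ-≋ {suc (position y)} p down ⟨
    suc (position y + p) % n    ≡⟨ suc-cong-≋ {position y + p} eq ⟩
    suc (position x + q) % n    ≡⟨ cong (_% n) (+-suc (position x) q) ⟨
    (position x + suc q) % n    ∎)
    where open ≡-Reasoning

  n≤oddCycle : (C : OddCycle doubledCycle) → n ≤ OddCycle.size C
  n≤oddCycle C with drift walk closing
    where open Cycle (OddCycle.cycle C)
  ... | p , q , p+q≡ , eq = subst (n ≤_) p+q≡
    (distinct-shifts⇒n≤ (position first) p q
      -- Equal counts would make the length `p + p`, which is even.
      (λ { refl → odd (subst (2 ∣_) (trans (cong (p +_) (+-identityʳ p)) p+q≡) (m∣m*n p)) })
      eq)
    where
    open OddCycle C
    open Cycle cycle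

  -- A cycle of length `n` inside one copy.

  vertexAt : ℕ → Vertex
  vertexAt k = combine {2} zero (k mod n)

  position-vertexAt : ∀ k → position (vertexAt k) ≡ k % n
  position-vertexAt k = trans (position-combine zero (k mod n)) (toℕ-fromℕ< (m%n<n k n))

  position-vertexAt-≋ : ∀ k → position (vertexAt k) ≋ k
  position-vertexAt-≋ k = trans (cong (_% n) (position-vertexAt k)) (m%n%n≡m%n k n)

  vertexAt-suc : ∀ k → suc (position (vertexAt k)) ≋ position (vertexAt (suc k))
  vertexAt-suc k = trans (suc-cong-≋ (position-vertexAt-≋ k)) (sym (position-vertexAt-≋ (suc k)))

  vertexAt-injective : ∀ {i j} → i < n → j < n → vertexAt i ≡ vertexAt j → i ≡ j
  vertexAt-injective {i} {j} i<n j<n eq = begin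
    i                      ≡⟨ m<n⇒m%n≡m i<n ⟨
    i % n                  ≡⟨ position-vertexAt i ⟨
    position (vertexAt i)  ≡⟨ cong position eq ⟩
    position (vertexAt j)  ≡⟨ position-vertexAt j ⟩
    j % n                  ≡⟨ m<n⇒m%n≡m j<n ⟩
    j                      ∎
    where open ≡-Reasoning

  -- Going downwards follows the recursion on `k` and lists the vertices in the order of
  -- `applyDownFrom`, which reduces distinctness to injectivity of `vertexAt` below `n`.
  descend : ∀ k → Star Adj (vertexAt k) (vertexAt 0)
  descend zero    = ε
  descend (suc k) = inj₂ (vertexAt-suc k) ◅ descend k

  vertices-descend : ∀ k → vertices (descend k) ≡ applyDownFrom vertexAt (suc k)
  vertices-descend zero    = refl
  vertices-descend (suc k) = cong (vertexAt (suc k) ∷_) (vertices-descend k)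

  length-descend : ∀ k → length (vertices (descend k)) ≡ suc k
  length-descend k = trans (cong length (vertices-descend k)) (length-applyDownFrom vertexAt (suc k))

  descend-isPath : ∀ {k} → k < n → IsPath (descend k)
  descend-isPath {k} k<n rewrite vertices-descend k =
    applyDownFrom⁺₁ vertexAt (suc k) λ j<i i≤k eq →
      let i<n = ≤-trans i≤k k<n in
      <⇒≢ j<i (sym (vertexAt-injective i<n (<-trans j<i i<n) eq))

  fullCycle : ∀ {k} → suc k ≡ n → Cycle Adj
  fullCycle {k} refl = record
    { walk    = descend k
    ; isPath  = descend-isPath ≤-refl
    -- The edge joins place 0 to place `k`, whose successor `n` is congruent to 0.
    ; closing = inj₂ (trans (vertexAt-suc k) (trans (position-vertexAt-≋ n)
                (trans (n%n≡0 n) (sym (position-vertexAt-≋ 0)))))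
    }

open DoubledCycle using (doubledCycle; twins; n≤oddCycle)

doubledCycle-oddCycle : ∀ k → let n = 3 + k in ¬ (2 ∣ n) → (1<n : 1 < n) →
                        Σ[ C ∈ OddCycle (doubledCycle n 1<n) ] OddCycle.size C ≡ n
doubledCycle-oddCycle k odd 1<n = record
  { cycle  = DoubledCycle.fullCycle n 1<n refl
  ; 3≤size = subst (3 ≤_) (sym size≡n) (m≤m+n 3 k)
  ; odd    = odd ∘ subst (2 ∣_) size≡n
  } , size≡n
  where
  n = 3 + k
  size≡n : length (vertices (DoubledCycle.descend n 1<n (2 + k))) ≡ n
  size≡n = DoubledCycle.length-descend n 1<n (2 + k)

theorem16 : ∀ (g : ℕ) → Σ[ G ∈ Graph ] (Σ[ γ ∈ ℕ∞ ] HasOddGirth G γ × [ g ] ≤∞ γ) × ¬ AOP G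
theorem16 g =
  G , ([ n ] , (C , n≤oddCycle n 1<n) , [ ≤-trans (m≤m+n g _) (m≤n+m (2 * g) 3) ]) ,
  twins∧oddCycle⇒¬AOP G (twins n 1<n) (proj₁ C)
  where
  -- Odd, at least 3 as a cycle length must be, and at least `g`.
  n = 3 + 2 * g
  1<n : 1 < n
  1<n = s≤s (s≤s z≤n)
  G = doubledCycle n 1<n
  n-odd : ¬ (2 ∣ n)
  n-odd 2∣n = from-no (2 ∣? 3) (∣m+n∣m⇒∣n (subst (2 ∣_) (+-comm 3 (2 * g)) 2∣n) (m∣m*n g))
  C = doubledCycle-oddCycle (2 * g) n-odd 1<n
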